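{- Let $s\ge0$ be an integer, $h\in\mathbb C\setminus\{0\}$ and $q\in\mathbb C\setminus\{0\}$. For all nonnegative integers $n,m$, as polynomials in $x$, $$B_{s,h,q}[n+m;x]=\sum_{r=0}^n\sum_{j=0}^mh^{n-r}q^{r(j(1-s)+sm)}\genfrac{[}{]}{0pt}{}{n}{r}_{q^s}S_{s,h,q}[m,j]\,B_{s,h,q}[r;x]\,x^j\prod_{i=0}^{n-r-1}[j(1-s)+sm+si]_q .$$ In particular, for $n\ge1$, $$B_{s,h,q}[n;x]=\sum_{r=0}^{n-1}h^{n-r-1}q^r\genfrac{[}{]}{0pt}{}{n-1}{r}_{q^s}B_{s,h,q}[r;x]\,x\prod_{i=0}^{n-r-2}[1+si]_q .$$ Moreover, writing $S_q[n,k]=S_{0,1,q}[n,k]$ and $B_q[n]=B_{0,1,q}[n;1]$, for all nonnegative integers $n,m$, $$B_q[n+m]=\sum_{r=0}^n\sum_{j=0}^mq^{rj}\binom nrS_q[m,j]\,B_q[r]\,[j]_q^{n-r},$$ where $0^0=1$.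
   Context: For an integer $x$, $[x]_q=\frac{q^x-1}{q-1}$ if $q\ne1$ and $[x]_1=x$. $\genfrac{[}{]}{0pt}{}{n}{k}_p$ is the Gaussian ($p$-binomial) coefficient, understood as a polynomial in $p$ evaluated at the given value. The numbers $S_{s,h,q}[n,k]$ are the coefficients in $(VU)^n=\sum_{k=0}^nS_{s,h,q}[n,k]V^{sn-(s-1)k}U^k$, where $UV-qVU=hV^s$; equivalently they are determined by $S_{s,h,q}[n,k]=q^{s(n-1)-(s-1)(k-1)}S_{s,h,q}[n-1,k-1]+h[s(n-1)-(s-1)k]_q\,S_{s,h,q}[n-1,k]$ for $n,k\ge1$, with $S_{s,h,q}[n,0]=S_{s,h,q}[0,n]=\delta_{0,n}$. The generalized $q$-Bell polynomials are $B_{s,h,q}[n;x]=\sum_{k=0}^nS_{s,h,q}[n,k]x^k$. Empty products equal $1$. -}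

module Defs where

open import Algebra.Apartness.Bundles
  using (HeytingField; module HeytingCommutativeRing)
open import Algebra.Bundles using (CommutativeRing; module Semiring)
import Algebra.Definitions.RawSemiring as RawSemiringDefs
import Algebra.Properties.CommutativeSemigroup as CommutativeSemigroupProperties
open import Data.Fin.Base using (toℕ)
open import Data.Integer.Base as ℤ using (ℤ; +_; -[1+_]; 1ℤ)
open import Data.List.Base using (List; []; _∷_; map; foldr)
open import Data.Nat.Base as ℕ using (ℕ; zero; suc; _≤_; z≤n; s≤s)
import Data.Nat.Properties as ℕ
open import Data.Product.Base using (proj₁)
import Data.Vec.Functional as Vector
import Relation.Binary.PropositionalEquality.Core as ≡
import Relation.Binary.Reasoning.Setoid as SetoidReasoning
open import Relation.Nullary.Decidable.Core using (Dec; yes; no)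

bigop : ∀ {a} {A : Set a} → (A → A → A) → A → ℕ → (ℕ → A) → A
bigop _∙_ ε n f = Vector.foldr _∙_ ε {n} (λ i → f (toℕ i))

module RingDefs {c ℓ} (R : CommutativeRing c ℓ) where
  open CommutativeRing R
  open RawSemiringDefs (Semiring.rawSemiring semiring) public using (_^_; _×_)

  ∏< : ℕ → (ℕ → Carrier) → Carrier
  ∏< = bigop _*_ 1#

  ∑< : ℕ → (ℕ → Carrier) → Carrier
  ∑< = bigop _+_ 0#

  infixr 5 ∑< ∏<
  syntax ∑< n (λ i → e) = ∑[ i < n ] e
  syntax ∏< n (λ i → e) = ∏[ i < n ] e

  fromℤ : ℤ → Carrier
  fromℤ (+ n)    = n × 1#
  fromℤ -[1+ n ] = - (suc n × 1#)

  -- The quotient of q-factorials is meaningless at roots of unity, so the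
  -- value at p of the polynomial is computed by the q-Pascal rule;
  -- gauss-factorial below is the usual product formula, valid for every p.
  gauss : ℕ → ℕ → Carrier → Carrier
  gauss n       zero    p = 1#
  gauss zero    (suc k) p = 0#
  gauss (suc n) (suc k) p = gauss n k p + p ^ suc k * gauss n (suc k) p

  -- qint n p = 1 + p + ⋯ + pⁿ⁻¹
  qint : ℕ → Carrier → Carrier
  qint zero    p = 0#
  qint (suc n) p = 1# + p * qint n p

  qfactorial : ℕ → Carrier → Carrier
  qfactorial zero    p = 1#
  qfactorial (suc n) p = qint (suc n) p * qfactorial n p

  private
    open SetoidReasoning setoid
    open CommutativeSemigroupProperties *-commutativeSemigroup
      using (x∙yz≈y∙xz; interchange; xy∙z≈xz∙y)

    qint-+ : ∀ m n p → qint (m ℕ.+ n) p ≈ qint m p + p ^ m * qint n p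
    qint-+ zero    n p = sym (trans (+-identityˡ _) (*-identityˡ _))
    qint-+ (suc m) n p = begin
      1# + p * qint (m ℕ.+ n) p                   ≈⟨ +-congˡ (*-congˡ (qint-+ m n p)) ⟩
      1# + p * (qint m p + p ^ m * qint n p)      ≈⟨ +-congˡ (distribˡ _ _ _) ⟩
      1# + (p * qint m p + p * (p ^ m * qint n p)) ≈⟨ +-assoc _ _ _ ⟨
      qint (suc m) p + p * (p ^ m * qint n p)     ≈⟨ +-congˡ (*-assoc _ _ _) ⟨
      qint (suc m) p + p ^ suc m * qint n p       ∎

    gauss-> : ∀ {n k} p → n ≤ k → gauss n (suc k) p ≈ 0#
    gauss-> {zero}          p z≤n     = refl
    gauss-> {suc n} {suc k} p (s≤s n≤k) = begin
      gauss n (suc k) p + p ^ suc (suc k) * gauss n (suc (suc k)) p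
        ≈⟨ +-cong (gauss-> p n≤k) (*-congˡ (gauss-> p (ℕ.m≤n⇒m≤1+n n≤k))) ⟩
      0# + p ^ suc (suc k) * 0#
        ≈⟨ trans (+-identityˡ _) (zeroʳ _) ⟩
      0# ∎

    gauss-diag : ∀ n p → gauss n n p ≈ 1#
    gauss-diag zero    p = refl
    gauss-diag (suc n) p = begin
      gauss n n p + p ^ suc n * gauss n (suc n) p
        ≈⟨ +-cong (gauss-diag n p) (*-congˡ (gauss-> {n} {n} p ℕ.≤-refl)) ⟩
      1# + p ^ suc n * 0#
        ≈⟨ trans (+-congˡ (zeroʳ _)) (+-identityʳ _) ⟩
      1# ∎

  gauss-factorial : ∀ k l p →
    gauss (k ℕ.+ l) k p * (qfactorial k p * qfactorial l p) ≈ qfactorial (k ℕ.+ l) p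
  gauss-factorial zero    l p = trans (*-identityˡ _) (*-identityˡ _)
  gauss-factorial (suc k) zero p rewrite ℕ.+-identityʳ k = begin
    gauss (suc k) (suc k) p * (qfactorial (suc k) p * 1#)
      ≈⟨ *-cong (gauss-diag (suc k) p) (*-identityʳ _) ⟩
    1# * qfactorial (suc k) p
      ≈⟨ *-identityˡ _ ⟩
    qfactorial (suc k) p ∎
  gauss-factorial (suc k) (suc l) p = begin
    (g + x * g′) * ((a * u) * (b * v))
      ≈⟨ distribʳ _ _ _ ⟩
    g * ((a * u) * (b * v)) + (x * g′) * ((a * u) * (b * v))
      ≈⟨ +-cong (trans (*-congˡ (*-assoc _ _ _)) (x∙yz≈y∙xz _ _ _))
                (trans (*-congˡ (x∙yz≈y∙xz _ _ _)) (interchange _ _ _ _)) ⟩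
    a * (g * (u * (b * v))) + (x * b) * (g′ * ((a * u) * v))
      ≈⟨ +-cong (*-congˡ (gauss-factorial k (suc l) p)) (*-congˡ step) ⟩
    a * w + (x * b) * w
      ≈⟨ distribʳ _ _ _ ⟨
    (a + x * b) * w
      ≈⟨ *-congʳ (qint-+ (suc k) (suc l) p) ⟨
    qint (suc k ℕ.+ suc l) p * w ∎
    where
    n  = k ℕ.+ suc l
    g  = gauss n k p
    g′ = gauss n (suc k) p
    x  = p ^ suc k
    a  = qint (suc k) p
    b  = qint (suc l) p
    u  = qfactorial k p
    v  = qfactorial l p
    w  = qfactorial n p
    step : g′ * ((a * u) * v) ≈ w
    step = ≡.subst
      (λ n → gauss n (suc k) p * ((a * u) * v) ≈ qfactorial n p)
      (≡.sym (ℕ.+-suc k l)) (gauss-factorial (suc k) l p)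

  -- a₀ ∷ a₁ ∷ ⋯ stands for a₀ + a₁x + ⋯; trailing zeros are allowed and
  -- are ignored by _≈ₚ_.
  Poly : Set c
  Poly = List Carrier

  infix  4 _≈ₚ_
  infixl 6 _+ₚ_
  infixr 7 _·ₚ_
  infixl 8 _*ₚ_
  infix  9 X^_

  coeff : Poly → ℕ → Carrier
  coeff []      i       = 0#
  coeff (a ∷ f) zero    = a
  coeff (a ∷ f) (suc i) = coeff f i

  _≈ₚ_ : Poly → Poly → Set ℓ
  f ≈ₚ g = ∀ i → coeff f i ≈ coeff g i

  _+ₚ_ : Poly → Poly → Poly
  []      +ₚ g       = g
  (a ∷ f) +ₚ []      = a ∷ f
  (a ∷ f) +ₚ (b ∷ g) = (a + b) ∷ (f +ₚ g)

  _·ₚ_ : Carrier → Poly → Poly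
  a ·ₚ f = map (a *_) f

  _*ₚ_ : Poly → Poly → Poly
  []      *ₚ g = []
  (a ∷ f) *ₚ g = a ·ₚ g +ₚ (0# ∷ f *ₚ g)

  X^_ : ℕ → Poly
  X^ zero  = 1# ∷ []
  X^ suc n = 0# ∷ X^ n

  ∑ₚ< : ℕ → (ℕ → Poly) → Poly
  ∑ₚ< = bigop _+ₚ_ []

  infixr 5 ∑ₚ<
  syntax ∑ₚ< n (λ i → e) = ∑ₚ[ i < n ] e

  eval : Poly → Carrier → Carrier
  eval f x = foldr (λ a v → a + x * v) 0# f

-- Apartness # plays the role of ≠. Equality in a Heyting field need not be
-- decidable, so the case split q = 1 / q ≠ 1 in [ x ] is an argument.
module QDefs {c ℓ₁ ℓ₂} (F : HeytingField c ℓ₁ ℓ₂)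
             (q : HeytingField.Carrier F)
             (q#0 : HeytingField._#_ F q (HeytingField.0# F))
             (q#1? : Dec (HeytingField._#_ F q (HeytingField.1# F)))
             where

  open HeytingField F
  open RingDefs
    (HeytingCommutativeRing.commutativeRing heytingCommutativeRing) public

  infix 9 q^_

  q^_ : ℤ → Carrier
  q^ (+ n)    = q ^ n
  q^ -[1+ n ] = proj₁ (#⇒invertible q#0) ^ suc n

  -- #⇒invertible q#1 supplies the inverse of q - 1#.
  bracket : Dec (q # 1#) → ℤ → Carrier
  bracket (yes q#1) x = (q^ x - 1#) * proj₁ (#⇒invertible q#1)
  bracket (no  _)   x = fromℤ x

  [_] : ℤ → Carrier
  [_] = bracket q#1?

  -- The exponent and the bracket may involve negative integers when k > n.
  S : ℕ → Carrier → ℕ → ℕ → Carrier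
  S s h zero    zero    = 1#
  S s h zero    (suc k) = 0#
  S s h (suc n) zero    = 0#
  S s h (suc n) (suc k) =
    q^ (+ s ℤ.* + n ℤ.- (+ s ℤ.- 1ℤ) ℤ.* + k) * S s h n k
    + h * [ + s ℤ.* + n ℤ.- (+ s ℤ.- 1ℤ) ℤ.* + suc k ] * S s h n (suc k)

  B : ℕ → Carrier → ℕ → Poly
  B s h n = ∑ₚ[ k < suc n ] S s h n k ·ₚ X^ k

  -- The specialisation s = 0, h = 1 (and x = 1 for the Bell numbers).
  Sq : ℕ → ℕ → Carrier
  Sq = S 0 1#

  Bq : ℕ → Carrier
  Bq n = eval (B 0 1# n) 1#

{-# OPTIONS --safe #-}
module Submission where

open import Defs
open import Algebra.Apartness.Bundles using (HeytingField; module HeytingCommutativeRing)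
open import Algebra.Bundles using (CommutativeRing)
import Algebra.Properties.CommutativeMonoid.Sum as CommutativeMonoidSum
import Algebra.Properties.Monoid.Mult as MonoidMult
import Algebra.Properties.Monoid.Sum as MonoidSum
import Algebra.Properties.Ring as RingProperties
import Algebra.Properties.Semiring.Exp as SemiringExp
import Algebra.Properties.Semiring.Sum as SemiringSum
import Algebra.Solver.Ring.NaturalCoefficients.Default as SemiringSolver
open import Data.Fin.Base using (toℕ)
open import Data.Integer.Base as ℤ using (ℤ; +_; -[1+_]; 0ℤ; 1ℤ)
import Data.Integer.Properties as ℤ
open import Data.Integer.Tactic.RingSolver using () renaming (solve-∀ to solveℤ)
open import Data.List.Base using ([]; _∷_)
open import Data.Nat.Base as ℕ using (ℕ; zero; suc; _∸_; _≤_; _<_; z≤n; s≤s)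
open import Data.Nat.Combinatorics using (_C_; nCk+nC[k+1]≡[n+1]C[k+1])
import Data.Nat.Properties as ℕ
open import Data.Product.Base as Product using (_,_; proj₁; proj₂)
open import Relation.Binary.PropositionalEquality.Core as ≡ using (_≡_)
import Relation.Binary.Reasoning.Setoid as SetoidReasoning
open import Relation.Nullary.Decidable.Core using (Dec; yes; no)

-- Normal ordering (VU)ⁿ Vᶜ defines polynomials T n c in x, where U ↦ x, with
--   T (n+1) c = qᶜ x T n (c+1) + h [c] T n (c+s),   B n = T n 0.
-- Splitting (VU)ⁿ⁺ᵐ = (VU)ⁿ (VU)ᵐ and normally ordering the right factor gives
--   B (n+m) = Σⱼ S[m,j] xʲ T n (sm-(s-1)j).
-- The corollary then follows from the addition formula
--   T n (c+d) = Σᵣ [n choose r]_{qˢ} q^{rc} hⁿ⁻ʳ ∏_{i<n-r} [c+si] T r d   at d = 0,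
-- an induction on n in which [a+b] = [a] + qᵃ [b] and the q-Pascal rule are used.

module RingLemmas {c ℓ} (R : CommutativeRing c ℓ) where
  open CommutativeRing R hiding (zero)
  open RingDefs R
  open SetoidReasoning setoid
  open SemiringSolver commutativeSemiring using (solve; con; _:+_; _:*_; _:=_)
  open SemiringSum semiring using (*-distribˡ-sum)

  -- Finite sums and products over initial segments of ℕ.

  ∑-cong : ∀ n {f g} → (∀ i → f i ≈ g i) → ∑< n f ≈ ∑< n g
  ∑-cong n f≈g = MonoidSum.sum-cong-≋ +-monoid {n} (λ i → f≈g (toℕ i))

  ∏-cong : ∀ n {f g} → (∀ i → f i ≈ g i) → ∏< n f ≈ ∏< n g
  ∏-cong n f≈g = MonoidSum.sum-cong-≋ *-monoid {n} (λ i → f≈g (toℕ i))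

  ∏-const : ∀ n x → (∏[ i < n ] x) ≈ x ^ n
  ∏-const n x = MonoidSum.sum-replicate *-monoid n

  ∑-distrib-+ : ∀ n f g → (∑[ i < n ] f i + g i) ≈ ∑< n f + ∑< n g
  ∑-distrib-+ n f g =
    CommutativeMonoidSum.∑-distrib-+ +-commutativeMonoid {n} (λ i → f (toℕ i)) (λ i → g (toℕ i))

  ∑-comm : ∀ m n (f : ℕ → ℕ → Carrier) →
    (∑[ i < m ] ∑[ j < n ] f i j) ≈ (∑[ j < n ] ∑[ i < m ] f i j)
  ∑-comm m n f =
    CommutativeMonoidSum.∑-comm +-commutativeMonoid {m} {n} (λ i j → f (toℕ i) (toℕ j))

  *-distribˡ-∑ : ∀ n x f → x * ∑< n f ≈ (∑[ i < n ] x * f i)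
  *-distribˡ-∑ n x f = *-distribˡ-sum {n} x (λ i → f (toℕ i))

  ∑-zero : ∀ n → (∑[ i < n ] 0#) ≈ 0#
  ∑-zero n = MonoidSum.sum-replicate-zero +-monoid n

  ∑-last : ∀ n f → ∑< (suc n) f ≈ ∑< n f + f n
  ∑-last zero    f = +-comm _ _
  ∑-last (suc n) f = trans (+-congˡ (∑-last n (λ i → f (suc i)))) (sym (+-assoc _ _ _))

  ∑-extend : ∀ n f → f n ≈ 0# → ∑< n f ≈ ∑< (suc n) f
  ∑-extend n f fn≈0 = sym (trans (∑-last n f) (trans (+-congˡ fn≈0) (+-identityʳ _)))

  -- The index shift trades the term at 0 for the term at `n`, and both are zero. It realigns the
  -- two halves of the recursion of `S` in `S-+`.
  ∑-suc : ∀ n f → f 0 ≈ 0# → f n ≈ 0# → (∑[ i < n ] f (suc i)) ≈ ∑< n f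
  ∑-suc n f f0≈0 fn≈0 = begin
    (∑[ i < n ] f (suc i))        ≈⟨ +-identityˡ _ ⟨
    0# + (∑[ i < n ] f (suc i))   ≈⟨ +-congʳ f0≈0 ⟨
    ∑< (suc n) f                  ≈⟨ ∑-extend n f fn≈0 ⟨
    ∑< n f                        ∎

  -- Coefficient sequences and multiplication by powers of x.

  -- Sequences ℕ → Carrier are coefficient sequences; shift j multiplies by xʲ.
  shift : ℕ → (ℕ → Carrier) → ℕ → Carrier
  shift zero    f i       = f i
  shift (suc j) f zero    = 0#
  shift (suc j) f (suc i) = shift j f i

  -- The coefficient sequence of the constant polynomial 1, so that `shift j δ` is that of xʲ.
  δ : ℕ → Carrier
  δ zero    = 1#
  δ (suc i) = 0#

  shift-cong : ∀ j {f g} → (∀ i → f i ≈ g i) → ∀ i → shift j f i ≈ shift j g i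
  shift-cong zero    f≈g i       = f≈g i
  shift-cong (suc j) f≈g zero    = refl
  shift-cong (suc j) f≈g (suc i) = shift-cong j f≈g i

  shift-1+ : ∀ j f i → shift j (shift 1 f) i ≈ shift (suc j) f i
  shift-1+ zero    f i       = refl
  shift-1+ (suc j) f zero    = refl
  shift-1+ (suc j) f (suc i) = shift-1+ j f i

  shift-linear : ∀ j a b f g i →
    shift j (λ k → a * f k + b * g k) i ≈ a * shift j f i + b * shift j g i
  shift-linear zero    a b f g i       = refl
  shift-linear (suc j) a b f g zero    =
    sym (trans (+-cong (zeroʳ a) (zeroʳ b)) (+-identityˡ 0#))
  shift-linear (suc j) a b f g (suc i) = shift-linear j a b f g i

  shift-∑ : ∀ j n (a : ℕ → Carrier) (f : ℕ → ℕ → Carrier) i →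
    shift j (λ k → ∑[ r < n ] a r * f r k) i ≈ (∑[ r < n ] a r * shift j (f r) i)
  shift-∑ zero    n a f i       = refl
  shift-∑ (suc j) n a f zero    =
    sym (trans (∑-cong n (λ r → zeroʳ (a r))) (∑-zero n))
  shift-∑ (suc j) n a f (suc i) = shift-∑ j n a f i

  -- A sequence that vanishes from `n` on is a polynomial of degree below `n`, hence the combination
  -- of its monomials. This reads off the coefficients of `B` and settles the base case of `S-+`.
  ∑-shift-δ : ∀ n a → (∀ i → n ≤ i → a i ≈ 0#) → ∀ i → (∑[ j < n ] a j * shift j δ i) ≈ a i
  ∑-shift-δ zero    a a≈0 i       = sym (a≈0 i z≤n)
  ∑-shift-δ (suc n) a a≈0 zero    = begin
    a 0 * 1# + (∑[ j < n ] a (suc j) * 0#)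
      ≈⟨ +-cong (*-identityʳ _) (trans (∑-cong n (λ j → zeroʳ (a (suc j)))) (∑-zero n)) ⟩
    a 0 + 0#
      ≈⟨ +-identityʳ _ ⟩
    a 0 ∎
  ∑-shift-δ (suc n) a a≈0 (suc i) = begin
    a 0 * 0# + (∑[ j < n ] a (suc j) * shift j δ i)
      ≈⟨ +-cong (zeroʳ _) (∑-shift-δ n (λ j → a (suc j)) (λ j n≤j → a≈0 (suc j) (s≤s n≤j)) i) ⟩
    0# + a (suc i)
      ≈⟨ +-identityˡ _ ⟩
    a (suc i) ∎

  -- Gaussian coefficients outside the triangle and at p = 1.

  gauss-> : ∀ {n k} p → n < k → gauss n k p ≈ 0#
  gauss-> {zero}  {suc k} p _         = refl
  gauss-> {suc n} {suc k} p (s≤s n<k) = begin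
    gauss n k p + p ^ suc k * gauss n (suc k) p
      ≈⟨ +-cong (gauss-> p n<k) (*-congˡ (gauss-> p (ℕ.m<n⇒m<1+n n<k))) ⟩
    0# + p ^ suc k * 0#
      ≈⟨ trans (+-identityˡ _) (zeroʳ _) ⟩
    0# ∎

  1^n≈1 : ∀ n → 1# ^ n ≈ 1#
  1^n≈1 zero    = refl
  1^n≈1 (suc n) = trans (*-identityˡ _) (1^n≈1 n)

  -- At p = 1 the q-Pascal rule becomes the ordinary Pascal rule. The case s = 0 needs this, since
  -- there p = q⁰.
  gauss-1 : ∀ n k → gauss n k 1# ≈ (n C k) × 1#
  gauss-1 zero    zero    = sym (+-identityʳ 1#)
  gauss-1 (suc n) zero    = sym (+-identityʳ 1#)
  gauss-1 zero    (suc k) = refl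
  gauss-1 (suc n) (suc k) = begin
    gauss n k 1# + 1# ^ suc k * gauss n (suc k) 1#
      ≈⟨ +-cong (gauss-1 n k) (trans (*-congʳ (1^n≈1 (suc k))) (trans (*-identityˡ _) (gauss-1 n (suc k)))) ⟩
    (n C k) × 1# + (n C suc k) × 1#
      ≈⟨ MonoidMult.×-homo-+ +-monoid 1# (n C k) (n C suc k) ⟨
    (n C k ℕ.+ n C suc k) × 1#
      ≡⟨ ≡.cong (_× 1#) (nCk+nC[k+1]≡[n+1]C[k+1] n k) ⟩
    (suc n C suc k) × 1# ∎

  -- Coefficients of polynomial expressions.

  coeff-+ₚ : ∀ f g i → coeff (f +ₚ g) i ≈ coeff f i + coeff g i
  coeff-+ₚ []      g       i       = sym (+-identityˡ _)
  coeff-+ₚ (a ∷ f) []      i       = sym (+-identityʳ _)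
  coeff-+ₚ (a ∷ f) (b ∷ g) zero    = refl
  coeff-+ₚ (a ∷ f) (b ∷ g) (suc i) = coeff-+ₚ f g i

  coeff-·ₚ : ∀ a f i → coeff (a ·ₚ f) i ≈ a * coeff f i
  coeff-·ₚ a []      i       = sym (zeroʳ a)
  coeff-·ₚ a (b ∷ f) zero    = refl
  coeff-·ₚ a (b ∷ f) (suc i) = coeff-·ₚ a f i

  coeff-∑ₚ : ∀ n f i → coeff (∑ₚ< n f) i ≈ (∑[ k < n ] coeff (f k) i)
  coeff-∑ₚ zero    f i = refl
  coeff-∑ₚ (suc n) f i =
    trans (coeff-+ₚ (f 0) _ i) (+-congˡ (coeff-∑ₚ n (λ k → f (suc k)) i))

  coeff-X^ : ∀ j i → coeff (X^ j) i ≈ shift j δ i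
  coeff-X^ zero    zero    = refl
  coeff-X^ zero    (suc i) = refl
  coeff-X^ (suc j) zero    = refl
  coeff-X^ (suc j) (suc i) = coeff-X^ j i

  coeff-*ₚ-X^ : ∀ f j i → coeff (f *ₚ X^ j) i ≈ shift j (coeff f) i
  coeff-*ₚ-X^ []      zero    i       = refl
  coeff-*ₚ-X^ []      (suc j) zero    = refl
  coeff-*ₚ-X^ []      (suc j) (suc i) = coeff-*ₚ-X^ [] j i
  coeff-*ₚ-X^ (a ∷ f) j       i       = begin
    coeff (a ·ₚ X^ j +ₚ (0# ∷ f *ₚ X^ j)) i
      ≈⟨ coeff-+ₚ (a ·ₚ X^ j) _ i ⟩
    coeff (a ·ₚ X^ j) i + coeff (0# ∷ f *ₚ X^ j) i
      ≈⟨ +-cong (trans (coeff-·ₚ a (X^ j) i) (*-congˡ (coeff-X^ j i))) (tail i) ⟩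
    a * shift j δ i + shift 1 (shift j (coeff f)) i
      ≈⟨ assemble j i ⟩
    shift j (coeff (a ∷ f)) i ∎
    where
    tail : ∀ i → coeff (0# ∷ f *ₚ X^ j) i ≈ shift 1 (shift j (coeff f)) i
    tail zero    = refl
    tail (suc i) = coeff-*ₚ-X^ f j i

    -- Coefficientwise form of a xʲ + x (xʲ f) = xʲ (a + x f), with the two factors x and xʲ
    -- commuted by recursion on both indices.
    assemble : ∀ j i → a * shift j δ i + shift 1 (shift j (coeff f)) i ≈ shift j (coeff (a ∷ f)) i
    assemble zero    zero          = trans (+-identityʳ _) (*-identityʳ a)
    assemble zero    (suc i)       = trans (+-congʳ (zeroʳ a)) (+-identityˡ _)
    assemble (suc j) zero          = trans (+-identityʳ _) (zeroʳ a)
    assemble (suc j) (suc zero)    = assemble j zero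
    assemble (suc j) (suc (suc i)) = assemble j (suc i)

  -- Evaluation of polynomials.

  eval-zero : ∀ f x → (∀ i → coeff f i ≈ 0#) → eval f x ≈ 0#
  eval-zero []      x f≈0 = refl
  eval-zero (a ∷ f) x f≈0 = begin
    a + x * eval f x   ≈⟨ +-cong (f≈0 0) (*-congˡ (eval-zero f x (λ i → f≈0 (suc i)))) ⟩
    0# + x * 0#        ≈⟨ trans (+-identityˡ _) (zeroʳ x) ⟩
    0#                 ∎

  -- Lists related by `_≈ₚ_` may differ in length; whatever one has beyond the other consists of
  -- zeros, which `eval-zero` removes.
  eval-cong : ∀ f g x → f ≈ₚ g → eval f x ≈ eval g x
  eval-cong []      g       x f≈g = sym (eval-zero g x (λ i → sym (f≈g i)))
  eval-cong (a ∷ f) []      x f≈g = eval-zero (a ∷ f) x f≈g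
  eval-cong (a ∷ f) (b ∷ g) x f≈g =
    +-cong (f≈g 0) (*-congˡ (eval-cong f g x (λ i → f≈g (suc i))))

  eval-+ₚ : ∀ f g x → eval (f +ₚ g) x ≈ eval f x + eval g x
  eval-+ₚ []      g       x = sym (+-identityˡ _)
  eval-+ₚ (a ∷ f) []      x = sym (+-identityʳ _)
  eval-+ₚ (a ∷ f) (b ∷ g) x =
    trans (+-congˡ (*-congˡ (eval-+ₚ f g x))) 
      (solve 5 (λ a b x u v → (a :+ b) :+ x :* (u :+ v) := (a :+ x :* u) :+ (b :+ x :* v))
        refl a b x (eval f x) (eval g x))

  eval-·ₚ : ∀ a f x → eval (a ·ₚ f) x ≈ a * eval f x
  eval-·ₚ a []      x = sym (zeroʳ a)
  eval-·ₚ a (b ∷ f) x =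
    trans (+-congˡ (*-congˡ (eval-·ₚ a f x))) 
      (solve 4 (λ a b x u → a :* b :+ x :* (a :* u) := a :* (b :+ x :* u)) refl a b x (eval f x))

  eval-*ₚ : ∀ f g x → eval (f *ₚ g) x ≈ eval f x * eval g x
  eval-*ₚ []      g x = sym (zeroˡ _)
  eval-*ₚ (a ∷ f) g x = begin
    eval (a ·ₚ g +ₚ (0# ∷ f *ₚ g)) x
      ≈⟨ eval-+ₚ (a ·ₚ g) _ x ⟩
    eval (a ·ₚ g) x + (0# + x * eval (f *ₚ g) x)
      ≈⟨ +-cong (eval-·ₚ a g x) (+-congˡ (*-congˡ (eval-*ₚ f g x))) ⟩
    a * eval g x + (0# + x * (eval f x * eval g x))
      ≈⟨ solve 4 (λ a x u v → a :* v :+ (con 0 :+ x :* (u :* v)) := (a :+ x :* u) :* v)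
           refl a x (eval f x) (eval g x) ⟩
    (a + x * eval f x) * eval g x ∎

  eval-X^-1 : ∀ j → eval (X^ j) 1# ≈ 1#
  eval-X^-1 zero    = trans (+-congˡ (zeroʳ 1#)) (+-identityʳ 1#)
  eval-X^-1 (suc j) = trans (+-identityˡ _) (trans (*-identityˡ _) (eval-X^-1 j))

  eval-∑ₚ : ∀ n f x → eval (∑ₚ< n f) x ≈ (∑[ k < n ] eval (f k) x)
  eval-∑ₚ zero    f x = refl
  eval-∑ₚ (suc n) f x =
    trans (eval-+ₚ (f 0) _ x) (+-congˡ (eval-∑ₚ n (λ k → f (suc k)) x))

module Convolution {c ℓ₁ ℓ₂} (F : HeytingField c ℓ₁ ℓ₂)
                   (q : HeytingField.Carrier F)
                   (q#0 : HeytingField._#_ F q (HeytingField.0# F))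
                   (q#1? : Dec (HeytingField._#_ F q (HeytingField.1# F)))
                   where

  open HeytingField F using (_#_; #⇒invertible; tight; heytingCommutativeRing)
  open HeytingCommutativeRing heytingCommutativeRing using (commutativeRing)
  open CommutativeRing commutativeRing hiding (zero)
  open QDefs F q q#0 q#1?
  open RingLemmas commutativeRing
  open RingProperties ring using (-0#≈0#; -‿distribʳ-*; -‿+-comm; +-cancelˡ)
  open SemiringExp semiring using (^-assocʳ)
  open SemiringSolver commutativeSemiring using (solve; con; _:+_; _:*_; _:=_)
  open SetoidReasoning setoid

  -- Addition laws for integer powers of q and for q-brackets.

  q⁻¹ : Carrier
  q⁻¹ = proj₁ (#⇒invertible q#0)

  -- `#⇒invertible q#0` inverts the difference `q - 0#`, which still has to be simplified to `q`.
  q⁻¹*q≈1 : q⁻¹ * q ≈ 1#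
  q⁻¹*q≈1 = begin
    q⁻¹ * q         ≈⟨ *-congˡ (trans (+-congˡ -0#≈0#) (+-identityʳ q)) ⟨
    q⁻¹ * (q - 0#)  ≈⟨ proj₁ (proj₂ (#⇒invertible q#0)) ⟩
    1#              ∎

  q⁻¹*[q*x]≈x : ∀ x → q⁻¹ * (q * x) ≈ x
  q⁻¹*[q*x]≈x x = trans (sym (*-assoc _ _ _)) (trans (*-congʳ q⁻¹*q≈1) (*-identityˡ x))

  q*[q⁻¹*x]≈x : ∀ x → q * (q⁻¹ * x) ≈ x
  q*[q⁻¹*x]≈x x = trans (sym (*-assoc _ _ _))
    (trans (*-congʳ (trans (*-comm q q⁻¹) q⁻¹*q≈1)) (*-identityˡ x))

  -- Exponents may be negative, so the predicate has to propagate both ways. The downward case is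
  -- structural because `ℤ.suc -[1+ suc n ]` computes to `-[1+ n ]`.
  ℤ-induction : ∀ {p} (P : ℤ → Set p) → P 0ℤ →
    (∀ a → P a → P (ℤ.suc a)) → (∀ a → P (ℤ.suc a) → P a) → ∀ a → P a
  ℤ-induction P P0 up down (+ zero)    = P0
  ℤ-induction P P0 up down (+ suc n)   = up (+ n) (ℤ-induction P P0 up down (+ n))
  ℤ-induction P P0 up down -[1+ zero ] = down -[1+ 0 ] P0
  ℤ-induction P P0 up down -[1+ suc n ] =
    down -[1+ suc n ] (ℤ-induction P P0 up down -[1+ n ])

  -- A first-order affine recurrence with invertible multiplier q determines a
  -- function on all of ℤ, which yields the addition laws of q^_ and [_].
  affine-unique : ∀ u {f g : ℤ → Carrier} → f 0ℤ ≈ g 0ℤ →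
    (∀ a → f (ℤ.suc a) ≈ u + q * f a) → (∀ a → g (ℤ.suc a) ≈ u + q * g a) →
    ∀ a → f a ≈ g a
  affine-unique u {f} {g} f0≈g0 f-suc g-suc = ℤ-induction (λ a → f a ≈ g a) f0≈g0
    (λ a fa≈ga → trans (f-suc a) (trans (+-congˡ (*-congˡ fa≈ga)) (sym (g-suc a))))
    (λ a e → begin
      f a              ≈⟨ q⁻¹*[q*x]≈x (f a) ⟨
      q⁻¹ * (q * f a)  ≈⟨ *-congˡ (+-cancelˡ u _ _ (trans (sym (f-suc a)) (trans e (g-suc a)))) ⟩
      q⁻¹ * (q * g a)  ≈⟨ q⁻¹*[q*x]≈x (g a) ⟩
      g a              ∎)

  q^-suc : ∀ a → q^ (ℤ.suc a) ≈ q * q^ a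
  q^-suc (+ n)        = refl
  q^-suc -[1+ zero  ] = sym (q*[q⁻¹*x]≈x 1#)
  q^-suc -[1+ suc n ] = sym (q*[q⁻¹*x]≈x (q^ -[1+ n ]))

  -- For fixed `b` both sides are multiplied by `q` when `a` increases by one: the recurrence with u
  -- = 0.
  q^-+ : ∀ a b → q^ (a ℤ.+ b) ≈ q^ a * q^ b
  q^-+ a b = affine-unique 0# {λ a → q^ (a ℤ.+ b)} {λ a → q^ a * q^ b}
    (trans (reflexive (≡.cong q^_ (ℤ.+-identityˡ b))) (sym (*-identityˡ _)))
    (λ a → begin
      q^ (ℤ.suc a ℤ.+ b)   ≡⟨ ≡.cong q^_ (ℤ.+-assoc 1ℤ a b) ⟩
      q^ ℤ.suc (a ℤ.+ b)   ≈⟨ q^-suc (a ℤ.+ b) ⟩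
      q * q^ (a ℤ.+ b)     ≈⟨ +-identityˡ _ ⟨
      0# + q * q^ (a ℤ.+ b) ∎)
    (λ a → begin
      q^ (ℤ.suc a) * q^ b      ≈⟨ *-congʳ (q^-suc a) ⟩
      q * q^ a * q^ b          ≈⟨ trans (*-assoc _ _ _) (sym (+-identityˡ _)) ⟩
      0# + q * (q^ a * q^ b)   ∎)
    a

  fromℤ-suc : ∀ a → fromℤ (ℤ.suc a) ≈ 1# + fromℤ a
  fromℤ-suc (+ n)        = refl
  fromℤ-suc -[1+ zero  ] = sym (trans (+-congˡ (-‿cong (+-identityʳ 1#))) (-‿inverseʳ 1#))
  fromℤ-suc -[1+ suc n ] = begin
    - y                    ≈⟨ +-identityˡ _ ⟨
    0# + - y               ≈⟨ +-congʳ (-‿inverseʳ 1#) ⟨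
    (1# + - 1#) + - y      ≈⟨ +-assoc _ _ _ ⟩
    1# + (- 1# + - y)      ≈⟨ +-congˡ (-‿+-comm 1# y) ⟩
    1# + - (1# + y)        ∎
    where y = suc n × 1#

  bracket-0 : ∀ d → bracket d 0ℤ ≈ 0#
  bracket-0 (yes q#1) = trans (*-congʳ (-‿inverseʳ 1#)) (zeroˡ _)
  bracket-0 (no _)    = refl

  -- One recurrence covers both definitions of the bracket, so no later argument splits on whether q
  -- = 1. For q apart from 1 it is the telescoping identity (q - 1) + q (qᵃ - 1) = qᵃ⁺¹ - 1, divided
  -- by q - 1.
  bracket-suc : ∀ d a → bracket d (ℤ.suc a) ≈ 1# + q * bracket d a
  bracket-suc (yes q#1) a = begin
    (q^ (ℤ.suc a) - 1#) * inv
      ≈⟨ *-congʳ (+-congʳ (q^-suc a)) ⟩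
    (q * q^ a - 1#) * inv
      ≈⟨ *-congʳ telescope ⟨
    ((q - 1#) + q * (q^ a - 1#)) * inv
      ≈⟨ distribʳ _ _ _ ⟩
    (q - 1#) * inv + q * (q^ a - 1#) * inv
      ≈⟨ +-cong (proj₂ (proj₂ (#⇒invertible q#1))) (*-assoc _ _ _) ⟩
    1# + q * ((q^ a - 1#) * inv) ∎
    where
    inv = proj₁ (#⇒invertible q#1)
    telescope : (q - 1#) + q * (q^ a - 1#) ≈ q * q^ a - 1#
    telescope = begin
      (q - 1#) + q * (q^ a - 1#)
        ≈⟨ +-congˡ (trans (distribˡ _ _ _) (+-congˡ (trans (sym (-‿distribʳ-* q 1#)) (-‿cong (*-identityʳ q))))) ⟩
      (q + - 1#) + (q * q^ a + - q)
        ≈⟨ solve 4 (λ x y z w → (x :+ y) :+ (z :+ w) := (x :+ w) :+ (z :+ y))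
             refl q (- 1#) (q * q^ a) (- q) ⟩
      (q + - q) + (q * q^ a - 1#)
        ≈⟨ trans (+-congʳ (-‿inverseʳ q)) (+-identityˡ _) ⟩
      q * q^ a - 1# ∎
  bracket-suc (no ¬q#1) a =
    -- Tightness of apartness turns "not apart from 1" into `q ≈ 1#`, so the factor `q` disappears.
    trans (fromℤ-suc a) (+-congˡ (sym (trans (*-congʳ (proj₁ (tight q 1#) ¬q#1)) (*-identityˡ _))))

  [0]≈0 : [ 0ℤ ] ≈ 0#
  [0]≈0 = bracket-0 q#1?

  -- For fixed `b` both sides obey f (a+1) = 1 + q f a and equal [b] at a = 0.
  []-+ : ∀ a b → [ a ℤ.+ b ] ≈ [ a ] + q^ a * [ b ]
  []-+ a b = affine-unique 1# {λ a → [ a ℤ.+ b ]} {λ a → [ a ] + q^ a * [ b ]}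
    (begin
      [ 0ℤ ℤ.+ b ]            ≡⟨ ≡.cong [_] (ℤ.+-identityˡ b) ⟩
      [ b ]                   ≈⟨ trans (+-identityˡ _) (*-identityˡ _) ⟨
      0# + 1# * [ b ]         ≈⟨ +-congʳ [0]≈0 ⟨
      [ 0ℤ ] + 1# * [ b ]     ∎)
    (λ a → begin
      [ ℤ.suc a ℤ.+ b ]       ≡⟨ ≡.cong [_] (ℤ.+-assoc 1ℤ a b) ⟩
      [ ℤ.suc (a ℤ.+ b) ]     ≈⟨ bracket-suc q#1? (a ℤ.+ b) ⟩
      1# + q * [ a ℤ.+ b ]    ∎)
    (λ a → begin
      [ ℤ.suc a ] + q^ (ℤ.suc a) * [ b ]
        ≈⟨ +-cong (bracket-suc q#1? a) (*-congʳ (q^-suc a)) ⟩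
      (1# + q * [ a ]) + q * q^ a * [ b ]
        ≈⟨ solve 4 (λ q x y z → (con 1 :+ q :* x) :+ q :* y :* z := con 1 :+ q :* (x :+ y :* z))
             refl q [ a ] (q^ a) [ b ] ⟩
      1# + q * ([ a ] + q^ a * [ b ]) ∎)
    a

  q^-suc* : ∀ r c → q^ (+ suc r ℤ.* c) ≈ q^ c * q^ (+ r ℤ.* c)
  q^-suc* r c = trans (reflexive (≡.cong q^_ (ℤ.suc-* (+ r) c))) (q^-+ c (+ r ℤ.* c))

  q^-*-+ : ∀ r c s → q^ (+ r ℤ.* (c ℤ.+ + s)) ≈ q^ (+ r ℤ.* c) * (q ^ s) ^ r
  q^-*-+ r c s = begin
    q^ (+ r ℤ.* (c ℤ.+ + s))
      ≡⟨ ≡.cong q^_ (ℤ.*-distribˡ-+ (+ r) c (+ s)) ⟩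
    q^ (+ r ℤ.* c ℤ.+ + r ℤ.* + s)
      ≈⟨ q^-+ (+ r ℤ.* c) (+ r ℤ.* + s) ⟩
    q^ (+ r ℤ.* c) * q^ (+ r ℤ.* + s)
      ≡⟨ ≡.cong (λ e → q^ (+ r ℤ.* c) * q^ e) (≡.trans (ℤ.*-comm (+ r) (+ s)) (≡.sym (ℤ.pos-* s r))) ⟩
    q^ (+ r ℤ.* c) * q ^ (s ℕ.* r)
      ≈⟨ *-congˡ (^-assocʳ q s r) ⟨
    q^ (+ r ℤ.* c) * (q ^ s) ^ r ∎

  -- The numbers `S` as coefficients of the Bell polynomials.

  module _ (s : ℕ) (h : Carrier) where

    S-> : ∀ {n k} → n < k → S s h n k ≈ 0#
    S-> {zero}  {suc k} _         = refl
    S-> {suc n} {suc k} (s≤s n<k) = trans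
      (+-cong (trans (*-congˡ (S-> n<k)) (zeroʳ _))
              (trans (*-congˡ (S-> (ℕ.m<n⇒m<1+n n<k))) (zeroʳ _)))
      (+-identityˡ 0#)

    coeff-B : ∀ n i → coeff (B s h n) i ≈ S s h n i
    coeff-B n i = begin
      coeff (B s h n) i
        ≈⟨ coeff-∑ₚ (suc n) (λ k → S s h n k ·ₚ X^ k) i ⟩
      (∑[ k < suc n ] coeff (S s h n k ·ₚ X^ k) i)
        ≈⟨ ∑-cong (suc n) (λ k → trans (coeff-·ₚ (S s h n k) (X^ k) i) (*-congˡ (coeff-X^ k i))) ⟩
      (∑[ k < suc n ] S s h n k * shift k δ i)
        ≈⟨ ∑-shift-δ (suc n) (S s h n) (λ _ → S->) i ⟩
      S s h n i ∎

    -- Normal ordering and the addition formula for `T`.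

    -- The exponent of V accompanying Uʲ in the normal ordering of (VU)ᵐ.
    weight : ℕ → ℕ → ℤ
    weight j m = + j ℤ.* (1ℤ ℤ.- + s) ℤ.+ + s ℤ.* + m

    weight-00 : weight 0 0 ≡ 0ℤ
    weight-00 = lemma (+ s)
      where
      lemma : ∀ s → 0ℤ ℤ.* (1ℤ ℤ.- s) ℤ.+ s ℤ.* 0ℤ ≡ 0ℤ
      lemma = solveℤ

    -- In the normal ordering of (VU)ⁿ Vᶜ, T n c k is the coefficient of the term
    -- with Uᵏ; the recursion moves the innermost factor VU past Vᶜ.
    T : ℕ → ℤ → ℕ → Carrier
    T zero    c i = δ i
    T (suc n) c i = q^ c * shift 1 (T n (c ℤ.+ 1ℤ)) i + h * [ c ] * T n (c ℤ.+ + s) i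

    -- A q-analogue of the rising factorial with step `s`, scaled by hᵏ. It is the coefficient of U⁰
    -- in the normal ordering of (VU)ᵏ Vᶜ.
    rising : ℕ → ℤ → Carrier
    rising k c = h ^ k * (∏[ i < k ] [ c ℤ.+ + s ℤ.* + i ])

    -- The factor [c] is the one at i = 0; the others move up by one index when c + s is absorbed.
    rising-suc : ∀ k c → h * [ c ] * rising k (c ℤ.+ + s) ≈ rising (suc k) c
    rising-suc k c = begin
      h * [ c ] * (h ^ k * (∏[ i < k ] [ c ℤ.+ + s ℤ.+ + s ℤ.* + i ]))
        ≈⟨ solve 4 (λ a b x y → a :* b :* (x :* y) := a :* x :* (b :* y)) refl _ _ _ _ ⟩
      h * h ^ k * ([ c ] * (∏[ i < k ] [ c ℤ.+ + s ℤ.+ + s ℤ.* + i ]))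
        ≈⟨ *-congˡ (*-cong (reflexive (≡.cong [_] (first c (+ s))))
             (∏-cong k (λ i → reflexive (≡.cong [_] (next c (+ s) (+ i)))))) ⟩
      h * h ^ k * ([ c ℤ.+ + s ℤ.* 0ℤ ] * (∏[ i < k ] [ c ℤ.+ + s ℤ.* + suc i ])) ∎
      where
      first : ∀ c s → c ≡ c ℤ.+ s ℤ.* 0ℤ
      first = solveℤ
      next : ∀ c s i → c ℤ.+ s ℤ.+ s ℤ.* i ≡ c ℤ.+ s ℤ.* (1ℤ ℤ.+ i)
      next = solveℤ

    T-term : ℕ → ℤ → ℕ → Carrier
    T-term n c r = gauss n r (q ^ s) * (q^ (+ r ℤ.* c) * rising (n ∸ r) c)

    -- The boundary r = 0, where the Gaussian coefficient is 1 and the q-Pascal rule does not enter.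
    T-term-zero : ∀ n c → h * [ c ] * T-term n (c ℤ.+ + s) 0 ≈ T-term (suc n) c 0
    T-term-zero n c = begin
      h * [ c ] * (1# * (q^ (+ 0 ℤ.* (c ℤ.+ + s)) * rising n (c ℤ.+ + s)))
        ≈⟨ solve 3 (λ a x y → a :* (con 1 :* (con 1 :* y)) := con 1 :* (con 1 :* (a :* y)))
             refl _ 1# _ ⟩
      1# * (1# * (h * [ c ] * rising n (c ℤ.+ + s)))
        ≈⟨ *-congˡ (*-congˡ (rising-suc n c)) ⟩
      1# * (1# * rising (suc n) c) ∎

    -- This is the q-Pascal rule at p = qˢ. The first summand turns qᶜ qʳᶜ into q⁽ʳ⁺¹⁾ᶜ; in the
    -- second, replacing c by c + s releases the factor pʳ⁺¹ that the rule requires.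
    T-term-suc : ∀ n c r →
      q^ c * T-term n c r + h * [ c ] * T-term n (c ℤ.+ + s) (suc r) ≈ T-term (suc n) c (suc r)
    T-term-suc n c r = begin
      q^ c * (g * (q^ (+ r ℤ.* c) * a)) + h * [ c ] * T-term n (c ℤ.+ + s) (suc r)
        ≈⟨ +-cong first second ⟩
      g * (x * a) + p ^ suc r * g′ * (x * a)
        ≈⟨ distribʳ (x * a) g (p ^ suc r * g′) ⟨
      (g + p ^ suc r * g′) * (x * a) ∎
      where
      p  = q ^ s
      g  = gauss n r p
      g′ = gauss n (suc r) p
      a  = rising (n ∸ r) c
      x  = q^ (+ suc r ℤ.* c)

      first : q^ c * (g * (q^ (+ r ℤ.* c) * a)) ≈ g * (x * a)
      first = begin
        q^ c * (g * (q^ (+ r ℤ.* c) * a))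
          ≈⟨ solve 4 (λ u g v a → u :* (g :* (v :* a)) := g :* (u :* v :* a)) refl _ _ _ _ ⟩
        g * (q^ c * q^ (+ r ℤ.* c) * a)
          ≈⟨ *-congˡ (*-congʳ (q^-suc* r c)) ⟨
        g * (x * a) ∎

      second : h * [ c ] * T-term n (c ℤ.+ + s) (suc r) ≈ p ^ suc r * g′ * (x * a)
      -- For r < n, `n ∸ r` is the successor of `n ∸ suc r` and `rising-suc` applies. Otherwise both
      -- truncated differences are 0, and the identity holds because `g′` vanishes.
      second with r ℕ.<? n
      ... | yes r<n = begin
        h * [ c ] * (g′ * (q^ (+ suc r ℤ.* (c ℤ.+ + s)) * rising (n ∸ suc r) (c ℤ.+ + s)))
          ≈⟨ *-congˡ (*-congˡ (*-congʳ (q^-*-+ (suc r) c s))) ⟩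
        h * [ c ] * (g′ * (x * p ^ suc r * rising (n ∸ suc r) (c ℤ.+ + s)))
          ≈⟨ solve 5 (λ u g x y b → u :* (g :* (x :* y :* b)) := y :* g :* (x :* (u :* b)))
               refl _ _ _ _ _ ⟩
        p ^ suc r * g′ * (x * (h * [ c ] * rising (n ∸ suc r) (c ℤ.+ + s)))
          ≈⟨ *-congˡ (*-congˡ (rising-suc (n ∸ suc r) c)) ⟩
        p ^ suc r * g′ * (x * rising (suc (n ∸ suc r)) c)
          ≡⟨ ≡.cong (λ k → p ^ suc r * g′ * (x * rising k c)) (≡.sym (ℕ.+-∸-assoc 1 r<n)) ⟩
        p ^ suc r * g′ * (x * a) ∎
      ... | no r≮n = trans (trans (*-congˡ (trans (*-congʳ g′≈0) (zeroˡ _))) (zeroʳ _))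
                       (sym (trans (*-congʳ (trans (*-congˡ g′≈0) (zeroʳ _))) (zeroˡ _)))
        where
        g′≈0 : g′ ≈ 0#
        g′≈0 = gauss-> p (s≤s (ℕ.≮⇒≥ r≮n))

    -- In [ c + d ] = [ c ] + q ^ c * [ d ], the summand with [ d ] reassembles the
    -- recursion of T (suc r) d, while the factor T n (c + d + s) next to [ c ] is
    -- expanded a second time, as T n ((c + s) + d).
    T-+ : ∀ n c d i → T n (c ℤ.+ d) i ≈ (∑[ r < suc n ] T-term n c r * T r d i)
    T-+ zero    c d i = solve 1 (λ y → y := con 1 :* (con 1 :* (con 1 :* con 1)) :* y :+ con 0) refl (δ i)
    T-+ (suc n) c d i = begin
      q^ (c ℤ.+ d) * shift 1 (T n (c ℤ.+ d ℤ.+ 1ℤ)) i + h * [ c ℤ.+ d ] * T n (c ℤ.+ d ℤ.+ + s) i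
        ≈⟨ +-cong (*-cong (q^-+ c d) shifted) (*-cong (*-congˡ ([]-+ c d)) lowered) ⟩
      q^ c * q^ d * ∑< (suc n) tx + h * ([ c ] + q^ c * [ d ]) * Y
        ≈⟨ solve 7 (λ u v X h b e Y → u :* v :* X :+ h :* (b :+ u :* e) :* Y
                        := u :* (v :* X :+ h :* e :* Y) :+ h :* b :* Y) refl _ _ _ _ _ _ _ ⟩
      q^ c * (q^ d * ∑< (suc n) tx + h * [ d ] * Y) + h * [ c ] * Y
        ≈⟨ +-cong (*-congˡ (trans (+-cong (*-distribˡ-∑ (suc n) (q^ d) tx) (*-distribˡ-∑ (suc n) (h * [ d ]) ty))
                                  (sym (∑-distrib-+ (suc n) (λ r → q^ d * tx r) (λ r → h * [ d ] * ty r)))))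
                  (*-congˡ (trans (sym lowered) raised)) ⟩
      q^ c * (∑[ r < suc n ] q^ d * tx r + h * [ d ] * ty r)
        + h * [ c ] * ∑< (suc n) t′z
        ≈⟨ +-cong (trans (*-distribˡ-∑ (suc n) (q^ c) (λ r → q^ d * tx r + h * [ d ] * ty r))
                         (∑-cong (suc n) regroup))
                  (trans (*-distribˡ-∑ (suc n) (h * [ c ]) t′z)
                         (∑-extend (suc n) (λ r → h * [ c ] * t′z r) vanish)) ⟩
      (∑[ r < suc n ] q^ c * t r * T (suc r) d i)
        + (h * [ c ] * t′z 0 + (∑[ r < suc n ] h * [ c ] * t′z (suc r)))
        -- The term r = 0 stands alone. Term r + 1 of the second sum is paired with term r of the
        -- first, since both carry `T (suc r) d`.
        ≈⟨ solve 3 (λ a b c → a :+ (b :+ c) := b :+ (a :+ c)) refl _ _ _ ⟩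
      h * [ c ] * t′z 0
        + ((∑[ r < suc n ] q^ c * t r * T (suc r) d i)
           + (∑[ r < suc n ] h * [ c ] * t′z (suc r)))
        ≈⟨ +-cong (trans (sym (*-assoc _ _ _)) (*-congʳ (T-term-zero n c)))
                  (trans (sym (∑-distrib-+ (suc n) (λ r → q^ c * t r * T (suc r) d i)
                                                   (λ r → h * [ c ] * t′z (suc r))))
                         (∑-cong (suc n) collect)) ⟩
      T-term (suc n) c 0 * T 0 d i + (∑[ r < suc n ] T-term (suc n) c (suc r) * T (suc r) d i) ∎
      where
      t t′ x y tx ty t′z : ℕ → Carrier
      t r  = T-term n c r
      t′ r = T-term n (c ℤ.+ + s) r
      x r  = shift 1 (T r (d ℤ.+ 1ℤ)) i
      y r  = T r (d ℤ.+ + s) i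
      tx r = t r * x r
      ty r = t r * y r
      t′z r = t′ r * T r d i

      Y : Carrier
      Y = ∑< (suc n) ty

      shifted : shift 1 (T n (c ℤ.+ d ℤ.+ 1ℤ)) i ≈ ∑< (suc n) tx
      shifted = begin
        shift 1 (T n (c ℤ.+ d ℤ.+ 1ℤ)) i
          ≡⟨ ≡.cong (λ e → shift 1 (T n e) i) (ℤ.+-assoc c d 1ℤ) ⟩
        shift 1 (T n (c ℤ.+ (d ℤ.+ 1ℤ))) i
          ≈⟨ shift-cong 1 (T-+ n c (d ℤ.+ 1ℤ)) i ⟩
        shift 1 (λ k → ∑[ r < suc n ] t r * T r (d ℤ.+ 1ℤ) k) i
          ≈⟨ shift-∑ 1 (suc n) t (λ r → T r (d ℤ.+ 1ℤ)) i ⟩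
        ∑< (suc n) tx ∎

      lowered : T n (c ℤ.+ d ℤ.+ + s) i ≈ Y
      lowered = trans (reflexive (≡.cong (λ e → T n e i) (ℤ.+-assoc c d (+ s))))
                      (T-+ n c (d ℤ.+ + s) i)

      raised : T n (c ℤ.+ d ℤ.+ + s) i ≈ ∑< (suc n) t′z
      raised = trans (reflexive (≡.cong (λ e → T n e i) (swap c d (+ s))))
                     (T-+ n (c ℤ.+ + s) d i)
        where
        swap : ∀ c d s → c ℤ.+ d ℤ.+ s ≡ c ℤ.+ s ℤ.+ d
        swap = solveℤ

      regroup : ∀ r → q^ c * (q^ d * tx r + h * [ d ] * ty r) ≈ q^ c * t r * T (suc r) d i
      regroup r = solve 6 (λ u v t x e y → u :* (v :* (t :* x) :+ e :* (t :* y))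
                              := u :* t :* (v :* x :+ e :* y)) refl _ _ _ (x r) _ (y r)

      -- The term r = n + 1, added so that the second sum splits into its head and n + 1 further
      -- terms, contains the zero `gauss n (suc n)`.
      vanish : h * [ c ] * t′z (suc n) ≈ 0#
      vanish = trans (*-congˡ (trans (*-congʳ
                 (trans (*-congʳ (gauss-> {n} (q ^ s) ℕ.≤-refl)) (zeroˡ _))) (zeroˡ _))) (zeroʳ _)

      collect : ∀ r → q^ c * t r * T (suc r) d i + h * [ c ] * t′z (suc r)
                    ≈ T-term (suc n) c (suc r) * T (suc r) d i
      collect r = trans (+-congˡ (sym (*-assoc _ _ _)))
                 (trans (sym (distribʳ _ _ _)) (*-congʳ (T-term-suc n c r)))

    -- Splitting (VU)ⁿ⁺ᵐ: the convolution for `S`.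

    -- For m = 0 the bracket is [0], and for m > 0 the number `S` is zero. This removes the boundary
    -- term j = 0 in `S-+`.
    S-zeroʳ : ∀ m → [ weight 0 m ] * S s h m 0 ≈ 0#
    S-zeroʳ zero    = trans (*-congʳ (trans (reflexive (≡.cong [_] weight-00)) [0]≈0)) (zeroˡ _)
    S-zeroʳ (suc m) = zeroʳ _

    S-suc : ∀ m j → S s h (suc m) (suc j) ≈
      q^ (weight j m) * S s h m j + h * [ weight (suc j) m ] * S s h m (suc j)
    S-suc m j = reflexive (≡.cong₂ (λ a b → q^ a * S s h m j + h * [ b ] * S s h m (suc j))
      (exponent (+ s) (+ m) (+ j)) (exponent (+ s) (+ m) (+ suc j)))
      where
      exponent : ∀ s m j → s ℤ.* m ℤ.- (s ℤ.- 1ℤ) ℤ.* j ≡ j ℤ.* (1ℤ ℤ.- s) ℤ.+ s ℤ.* m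
      exponent = solveℤ

    -- Induction on `n` for all `m`, passing one factor VU from the left block to the right. After
    -- the recursion of `S` is applied to row m + 1, the term from column j raises the weight by 1
    -- together with a factor x, and the term that stays in column j raises it by s. These are the
    -- two terms of the recursion of `T`.
    S-+ : ∀ n m i → S s h (n ℕ.+ m) i ≈ (∑[ j < suc m ] S s h m j * shift j (T n (weight j m)) i)
    S-+ zero    m i = sym (∑-shift-δ (suc m) (S s h m) (λ _ → S->) i)
    S-+ (suc n) m i = begin
      S s h (suc n ℕ.+ m) i
        ≡⟨ ≡.cong (λ k → S s h k i) (≡.sym (ℕ.+-suc n m)) ⟩
      S s h (n ℕ.+ suc m) i
        ≈⟨ S-+ n (suc m) i ⟩
      -- The recursion of `S` starts at column 1; column 0 of row m + 1 is zero by definition.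
      0# * g 0 + (∑[ j < suc m ] S s h (suc m) (suc j) * g (suc j))
        ≈⟨ trans (+-congʳ (zeroˡ _)) (+-identityˡ _) ⟩
      (∑[ j < suc m ] S s h (suc m) (suc j) * g (suc j))
        ≈⟨ ∑-cong (suc m) (λ j → trans (*-congʳ (S-suc m j)) (distribʳ (g (suc j)) _ _)) ⟩
      (∑[ j < suc m ] v j + u (suc j))
        ≈⟨ ∑-distrib-+ (suc m) v (λ j → u (suc j)) ⟩
      ∑< (suc m) v + (∑[ j < suc m ] u (suc j))
        -- The sum of `u` over 1 to m + 1 becomes one over 0 to m: `u 0` vanishes by `S-zeroʳ`, and
        -- `u (suc m)` lies above the diagonal of `S`.
        ≈⟨ +-congˡ (∑-suc (suc m) u u-zero u-last) ⟩
      ∑< (suc m) v + ∑< (suc m) u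
        ≈⟨ ∑-distrib-+ (suc m) v u ⟨
      (∑[ j < suc m ] v j + u j)
        ≈⟨ ∑-cong (suc m) step ⟩
      (∑[ j < suc m ] S s h m j * shift j (T (suc n) (weight j m)) i) ∎
      where
      g u v : ℕ → Carrier
      g j = shift j (T n (weight j (suc m))) i
      u j = h * [ weight j m ] * S s h m j * g j
      v j = q^ (weight j m) * S s h m j * g (suc j)

      u-zero : u 0 ≈ 0#
      u-zero = trans (*-congʳ (trans (*-assoc _ _ _) (trans (*-congˡ (S-zeroʳ m)) (zeroʳ _)))) (zeroˡ _)

      u-last : u (suc m) ≈ 0#
      u-last = trans (*-congʳ (trans (*-congˡ (S-> {m} ℕ.≤-refl)) (zeroʳ _))) (zeroˡ _)

      weight-suc-suc : ∀ s m j →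
        (1ℤ ℤ.+ j) ℤ.* (1ℤ ℤ.- s) ℤ.+ s ℤ.* (1ℤ ℤ.+ m) ≡ j ℤ.* (1ℤ ℤ.- s) ℤ.+ s ℤ.* m ℤ.+ 1ℤ
      weight-suc-suc = solveℤ

      weight-suc : ∀ s m j →
        j ℤ.* (1ℤ ℤ.- s) ℤ.+ s ℤ.* (1ℤ ℤ.+ m) ≡ j ℤ.* (1ℤ ℤ.- s) ℤ.+ s ℤ.* m ℤ.+ s
      weight-suc = solveℤ

      step : ∀ j → v j + u j ≈ S s h m j * shift j (T (suc n) (weight j m)) i
      step j = begin
        q^ w * S s h m j * g (suc j) + h * [ w ] * S s h m j * g j
          ≡⟨ ≡.cong₂ (λ a b → q^ w * S s h m j * shift (suc j) (T n a) i
                              + h * [ w ] * S s h m j * shift j (T n b) i)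
               (weight-suc-suc (+ s) (+ m) (+ j)) (weight-suc (+ s) (+ m) (+ j)) ⟩
        q^ w * S s h m j * shift (suc j) (T n (w ℤ.+ 1ℤ)) i
          + h * [ w ] * S s h m j * shift j (T n (w ℤ.+ + s)) i
          ≈⟨ +-congʳ (*-congˡ (shift-1+ j (T n (w ℤ.+ 1ℤ)) i)) ⟨
        q^ w * S s h m j * shift j (shift 1 (T n (w ℤ.+ 1ℤ))) i
          + h * [ w ] * S s h m j * shift j (T n (w ℤ.+ + s)) i
          ≈⟨ solve 5 (λ a S X b Y → a :* S :* X :+ b :* S :* Y := S :* (a :* X :+ b :* Y))
               refl _ _ _ _ _ ⟩
        S s h m j * (q^ w * shift j (shift 1 (T n (w ℤ.+ 1ℤ))) i
          + h * [ w ] * shift j (T n (w ℤ.+ + s)) i)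
          ≈⟨ *-congˡ (shift-linear j (q^ w) (h * [ w ])
               (shift 1 (T n (w ℤ.+ 1ℤ))) (T n (w ℤ.+ + s)) i) ⟨
        S s h m j * shift j (T (suc n) w) i ∎
        where w = weight j m

    -- The Bell polynomial identities.

    -- The case m = 0 of `S-+`, where the right block is empty and has weight 0.
    T-0≈S : ∀ n i → T n 0ℤ i ≈ S s h n i
    T-0≈S n i = sym (begin
      S s h n i                              ≡⟨ ≡.cong (λ k → S s h k i) (≡.sym (ℕ.+-identityʳ n)) ⟩
      S s h (n ℕ.+ 0) i                      ≈⟨ S-+ n 0 i ⟩
      1# * T n (weight 0 0) i + 0#           ≈⟨ trans (+-identityʳ _) (*-identityˡ _) ⟩
      T n (weight 0 0) i                     ≡⟨ ≡.cong (λ e → T n e i) weight-00 ⟩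
      T n 0ℤ i                               ∎)

    T-expand : ∀ n c i → T n c i ≈ (∑[ r < suc n ] T-term n c r * S s h r i)
    T-expand n c i = begin
      T n c i            ≡⟨ ≡.cong (λ e → T n e i) (≡.sym (ℤ.+-identityʳ c)) ⟩
      T n (c ℤ.+ 0ℤ) i   ≈⟨ T-+ n c 0ℤ i ⟩
      (∑[ r < suc n ] T-term n c r * T r 0ℤ i)
        ≈⟨ ∑-cong (suc n) (λ r → *-congˡ {T-term n c r} (T-0≈S r i)) ⟩
      (∑[ r < suc n ] T-term n c r * S s h r i) ∎

    shift-T-expand : ∀ j n c i →
      shift j (T n c) i ≈ (∑[ r < suc n ] T-term n c r * shift j (S s h r) i)
    shift-T-expand j n c i = trans (shift-cong j (T-expand n c) i)
      (shift-∑ j (suc n) (T-term n c) (S s h) i)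

    coeff-·-B-X^ : ∀ a r j i → coeff (a ·ₚ B s h r *ₚ X^ j) i ≈ a * shift j (S s h r) i
    coeff-·-B-X^ a r j i = begin
      coeff (a ·ₚ B s h r *ₚ X^ j) i          ≈⟨ coeff-·ₚ a (B s h r *ₚ X^ j) i ⟩
      a * coeff (B s h r *ₚ X^ j) i           ≈⟨ *-congˡ (coeff-*ₚ-X^ (B s h r) j i) ⟩
      a * shift j (coeff (B s h r)) i         ≈⟨ *-congˡ (shift-cong j (coeff-B r) i) ⟩
      a * shift j (S s h r) i                 ∎

    -- Coefficientwise, `S-+` gives a sum over j; expanding each `T n (weight j m)` at d = 0 brings
    -- in the coefficients of `B s h r`, and exchanging the sums puts r outside.
    B-+ : ∀ n m → B s h (n ℕ.+ m) ≈ₚ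
      (∑ₚ[ r < suc n ] ∑ₚ[ j < suc m ]
        (h ^ (n ∸ r) * q^ (+ r ℤ.* weight j m) * gauss n r (q ^ s) * S s h m j
          * (∏[ i < n ∸ r ] [ weight j m ℤ.+ + s ℤ.* + i ]))
        ·ₚ B s h r *ₚ X^ j)
    B-+ n m i = begin
      coeff (B s h (n ℕ.+ m)) i
        ≈⟨ coeff-B (n ℕ.+ m) i ⟩
      S s h (n ℕ.+ m) i
        ≈⟨ S-+ n m i ⟩
      (∑[ j < suc m ] S s h m j * shift j (T n (weight j m)) i)
        ≈⟨ ∑-cong (suc m) (λ j → trans (*-congˡ (shift-T-expand j n (weight j m) i))
                                       (*-distribˡ-∑ (suc n) (S s h m j) (e j))) ⟩
      (∑[ j < suc m ] ∑[ r < suc n ] S s h m j * e j r)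
        ≈⟨ ∑-comm (suc m) (suc n) (λ j r → S s h m j * e j r) ⟩
      (∑[ r < suc n ] ∑[ j < suc m ] S s h m j * e j r)
        ≈⟨ ∑-cong (suc n) (λ r → ∑-cong (suc m) (regroup r)) ⟩
      (∑[ r < suc n ] ∑[ j < suc m ] a r j * shift j (S s h r) i)
        ≈⟨ ∑-cong (suc n) (λ r → ∑-cong (suc m) (λ j → coeff-·-B-X^ (a r j) r j i)) ⟨
      (∑[ r < suc n ] ∑[ j < suc m ] coeff (a r j ·ₚ B s h r *ₚ X^ j) i)
        ≈⟨ ∑-cong (suc n) (λ r → coeff-∑ₚ (suc m) (λ j → a r j ·ₚ B s h r *ₚ X^ j) i) ⟨
      (∑[ r < suc n ] coeff (∑ₚ[ j < suc m ] a r j ·ₚ B s h r *ₚ X^ j) i)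
        ≈⟨ coeff-∑ₚ (suc n) (λ r → ∑ₚ[ j < suc m ] a r j ·ₚ B s h r *ₚ X^ j) i ⟨
      coeff (∑ₚ[ r < suc n ] ∑ₚ[ j < suc m ] a r j ·ₚ B s h r *ₚ X^ j) i ∎
      where
      a : ℕ → ℕ → Carrier
      a r j = h ^ (n ∸ r) * q^ (+ r ℤ.* weight j m) * gauss n r (q ^ s) * S s h m j
        * (∏[ i < n ∸ r ] [ weight j m ℤ.+ + s ℤ.* + i ])

      e : ℕ → ℕ → Carrier
      e j r = T-term n (weight j m) r * shift j (S s h r) i

      regroup : ∀ r j → S s h m j * e j r ≈ a r j * shift j (S s h r) i
      regroup r j =
        solve 6 (λ S g x y z w → S :* (g :* (x :* (y :* z)) :* w) := y :* x :* g :* S :* z :* w)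
          refl _ _ _ _ _ _

    -- Since [0] = 0, the recursion of `T` at c = 0 keeps only x `T n 1ℤ`, and the addition formula
    -- expands this with c = 1 and d = 0.
    B-suc : ∀ n → 1 ≤ n → B s h n ≈ₚ
      (∑ₚ[ r < n ]
        (h ^ (n ∸ r ∸ 1) * q ^ r * gauss (n ∸ 1) r (q ^ s)
          * (∏[ i < n ∸ r ∸ 1 ] [ 1ℤ ℤ.+ + s ℤ.* + i ]))
        ·ₚ B s h r *ₚ X^ 1)
    B-suc (suc n) _ i = begin
      coeff (B s h (suc n)) i
        ≈⟨ coeff-B (suc n) i ⟩
      S s h (suc n) i
        ≈⟨ T-0≈S (suc n) i ⟨
      1# * shift 1 (T n 1ℤ) i + h * [ 0ℤ ] * T n (+ s) i
        ≈⟨ +-cong (*-identityˡ _)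
             (trans (*-congʳ (trans (*-congˡ [0]≈0) (zeroʳ h))) (zeroˡ _)) ⟩
      shift 1 (T n 1ℤ) i + 0#
        ≈⟨ trans (+-identityʳ _) (shift-T-expand 1 n 1ℤ i) ⟩
      (∑[ r < suc n ] T-term n 1ℤ r * shift 1 (S s h r) i)
        ≈⟨ ∑-cong (suc n) (λ r → trans (*-congʳ {shift 1 (S s h r) i} (term r)) (sym (coeff-·-B-X^ (a r) r 1 i))) ⟩
      (∑[ r < suc n ] coeff (a r ·ₚ B s h r *ₚ X^ 1) i)
        ≈⟨ coeff-∑ₚ (suc n) (λ r → a r ·ₚ B s h r *ₚ X^ 1) i ⟨
      coeff (∑ₚ[ r < suc n ] a r ·ₚ B s h r *ₚ X^ 1) i ∎
      where
      b : ℕ → ℕ → Carrier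
      b r k = h ^ k * q ^ r * gauss n r (q ^ s) * (∏[ i < k ] [ 1ℤ ℤ.+ + s ℤ.* + i ])

      a : ℕ → Carrier
      a r = b r (suc n ∸ r ∸ 1)

      term : ∀ r → T-term n 1ℤ r ≈ a r
      term r = begin
        gauss n r (q ^ s) * (q^ (+ r ℤ.* 1ℤ) * rising (n ∸ r) 1ℤ)
          ≡⟨ ≡.cong (λ e → gauss n r (q ^ s) * (q^ e * rising (n ∸ r) 1ℤ)) (ℤ.*-identityʳ (+ r)) ⟩
        gauss n r (q ^ s) * (q ^ r * rising (n ∸ r) 1ℤ)
          ≈⟨ solve 4 (λ g x y z → g :* (x :* (y :* z)) := y :* x :* g :* z) refl _ _ _ _ ⟩
        b r (n ∸ r)
          -- Subtracting r and then 1 from n + 1 leaves `n ∸ r`, also under truncation.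
          ≡⟨ ≡.cong (b r) (≡.sym (≡.trans (ℕ.∸-+-assoc (suc n) r 1) (≡.cong (suc n ∸_) (ℕ.+-comm r 1)))) ⟩
        a r ∎

  -- The q-Bell numbers.

  -- With s = 0 the weight is j and every bracket in the product is [j], so the product is a power.
  -- For r = n it is empty and equals 1, in agreement with 0⁰ = 1 when j = 0.
  Bq-+ : ∀ n m → Bq (n ℕ.+ m) ≈
    (∑[ r < suc n ] ∑[ j < suc m ]
      q ^ (r ℕ.* j) * ((n C r) × 1#) * Sq m j * Bq r * [ + j ] ^ (n ∸ r))
  Bq-+ n m = begin
    Bq (n ℕ.+ m)
      ≈⟨ eval-cong (B 0 1# (n ℕ.+ m)) (∑ₚ[ r < suc n ] ∑ₚ[ j < suc m ] f r j) 1# (B-+ 0 1# n m) ⟩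
    eval (∑ₚ[ r < suc n ] ∑ₚ[ j < suc m ] f r j) 1#
      ≈⟨ eval-∑ₚ (suc n) (λ r → ∑ₚ[ j < suc m ] f r j) 1# ⟩
    (∑[ r < suc n ] eval (∑ₚ[ j < suc m ] f r j) 1#)
      ≈⟨ ∑-cong (suc n) (λ r → eval-∑ₚ (suc m) (f r) 1#) ⟩
    (∑[ r < suc n ] ∑[ j < suc m ] eval (f r j) 1#)
      ≈⟨ ∑-cong (suc n) (λ r → ∑-cong (suc m) (term r)) ⟩
    (∑[ r < suc n ] ∑[ j < suc m ]
      q ^ (r ℕ.* j) * ((n C r) × 1#) * Sq m j * Bq r * [ + j ] ^ (n ∸ r)) ∎
    where
    a : ℕ → ℕ → Carrier
    a r j = 1# ^ (n ∸ r) * q^ (+ r ℤ.* weight 0 1# j m) * gauss n r (q ^ 0) * Sq m j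
      * (∏[ i < n ∸ r ] [ weight 0 1# j m ℤ.+ + 0 ℤ.* + i ])

    f : ℕ → ℕ → Poly
    f r j = a r j ·ₚ B 0 1# r *ₚ X^ j

    weight≡j : ∀ j m → j ℤ.* (1ℤ ℤ.- 0ℤ) ℤ.+ 0ℤ ℤ.* m ≡ j
    weight≡j = solveℤ

    step≡j : ∀ j m i → j ℤ.* (1ℤ ℤ.- 0ℤ) ℤ.+ 0ℤ ℤ.* m ℤ.+ 0ℤ ℤ.* i ≡ j
    step≡j = solveℤ

    term : ∀ r j → eval (f r j) 1# ≈
      q ^ (r ℕ.* j) * ((n C r) × 1#) * Sq m j * Bq r * [ + j ] ^ (n ∸ r)
    term r j = begin
      eval (f r j) 1#
        ≈⟨ eval-·ₚ (a r j) (B 0 1# r *ₚ X^ j) 1# ⟩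
      a r j * eval (B 0 1# r *ₚ X^ j) 1#
        ≈⟨ *-congˡ (trans (eval-*ₚ (B 0 1# r) (X^ j) 1#) (*-congˡ (eval-X^-1 j))) ⟩
      a r j * (Bq r * 1#)
        ≈⟨ *-congʳ (*-cong (*-congʳ (*-cong (*-cong (1^n≈1 (n ∸ r)) (reflexive power)) (gauss-1 n r)))
             (trans (∏-cong (n ∸ r) (λ i → reflexive (≡.cong [_] (step≡j (+ j) (+ m) (+ i)))))
                    (∏-const (n ∸ r) [ + j ]))) ⟩
      1# * q ^ (r ℕ.* j) * ((n C r) × 1#) * Sq m j * [ + j ] ^ (n ∸ r) * (Bq r * 1#)
        ≈⟨ solve 5 (λ x y z w v → con 1 :* x :* y :* z :* w :* (v :* con 1) := x :* y :* z :* v :* w)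
             refl _ _ _ _ _ ⟩
      q ^ (r ℕ.* j) * ((n C r) × 1#) * Sq m j * Bq r * [ + j ] ^ (n ∸ r) ∎
      where
      power : q^ (+ r ℤ.* weight 0 1# j m) ≡ q ^ (r ℕ.* j)
      power = ≡.cong q^_ (≡.trans (≡.cong (+ r ℤ.*_) (weight≡j (+ j) (+ m))) (≡.sym (ℤ.pos-* r j)))

corollary19 :
  ∀ {c ℓ₁ ℓ₂} (F : HeytingField c ℓ₁ ℓ₂) → let open HeytingField F in
  (q : Carrier) (q#0 : q # 0#) (q#1? : Dec (q # 1#)) →
  let open QDefs F q q#0 q#1? in
  ((s : ℕ) (h : Carrier) → h # 0# →
    ((n m : ℕ) →
      B s h (n ℕ.+ m) ≈ₚ
        (∑ₚ[ r < suc n ] ∑ₚ[ j < suc m ]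
          (h ^ (n ∸ r)
            * q^ (+ r ℤ.* (+ j ℤ.* (1ℤ ℤ.- + s) ℤ.+ + s ℤ.* + m))
            * gauss n r (q ^ s)
            * S s h m j
            * (∏[ i < n ∸ r ] [ + j ℤ.* (1ℤ ℤ.- + s) ℤ.+ + s ℤ.* + m ℤ.+ + s ℤ.* + i ]))
          ·ₚ B s h r *ₚ X^ j))
    Product.×
    ((n : ℕ) → 1 ≤ n →
      B s h n ≈ₚ
        (∑ₚ[ r < n ]
          (h ^ (n ∸ r ∸ 1)
            * q ^ r
            * gauss (n ∸ 1) r (q ^ s)
            * (∏[ i < n ∸ r ∸ 1 ] [ 1ℤ ℤ.+ + s ℤ.* + i ]))
          ·ₚ B s h r *ₚ X^ 1)))
  Product.×
  ((n m : ℕ) →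
    Bq (n ℕ.+ m) ≈
      (∑[ r < suc n ] ∑[ j < suc m ]
        q ^ (r ℕ.* j) * ((n C r) × 1#) * Sq m j * Bq r * [ + j ] ^ (n ∸ r)))
corollary19 F q q#0 q#1? = (λ s h _ → B-+ s h , B-suc s h) , Bq-+
  where open Convolution F q q#0 q#1?
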